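{- Let $A$ and $B$ be finite non-empty subsets of $\mathbb{Z}$ with $|A| \ge |B|$. Then there exist elements $b_1,b_2,b_3 \in B$ such that $$|A+\{b_1,b_2,b_3\}| \ge |A|+|B|-1.$$
   Context: For subsets $X,Y$ of an abelian group, $X+Y=\{x+y : x\in X, y\in Y\}$. The elements $b_1,b_2,b_3$ are not required to be distinct. -}

module Defs where

open import Data.Integer using (ℤ; _+_; _≟_)
open import Data.List using (List; length; deduplicate; cartesianProductWith)
open import Data.Nat using (ℕ)

-- A finite subset of ℤ is given by a list enumerating its elements;
-- order and repetitions are irrelevant, so cardinality counts distinct
-- entries.
FinSubset : Set
FinSubset = List ℤ

∣_∣ : FinSubset → ℕ
∣ X ∣ = length (deduplicate _≟_ X)

infixl 6 _⊕_

_⊕_ : FinSubset → FinSubset → FinSubset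
X ⊕ Y = cartesianProductWith _+_ X Y

{-# OPTIONS --safe #-}
-- Let b₀ = min B, b₁ = max B, d = b₁ - b₀ > 0 and n = |B| - 1. The set U of
-- those u ∈ A with u + b₁ ∉ A + b₀ contains the largest element of A in each
-- class modulo d, and |A + {b₀, b₁}| = |A| + |U|. A translate a + b whose class
-- is not met by A + b₀ lies outside A + {b₀, b₁}. The n elements of B \ {b₁} are
-- distinct modulo d, so for each a ∈ A at least n - |U| of these b give such a
-- translate. As |A| ≥ n, averaging over b yields one b that adds at least
-- n - |U| translates, whence |A + {b₀, b₁, b}| ≥ |A| + n.
module Submission where

open import Data.Integer as ℤ using (ℤ; +_; _%ℕ_; _/ℕ_) renaming (∣_∣ to ∣_∣ᶻ)
open import Data.Integer.DivMod using (a≡a%ℕn+[a/ℕn]*n; n%ℕd<d)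
import Data.Integer.Properties as ℤ
open import Data.Integer.Tactic.RingSolver using (solve-∀)
open import Data.List using (List; []; _∷_; _++_; length; map; filter; deduplicate)
open import Data.List.Extrema ℤ.≤-totalOrder using (max; min; argmax-all; argmin-all; ⊥≤max; xs≤max; min≤⊤; min≤xs)
open import Data.List.Membership.DecPropositional ℤ._≟_ using () renaming (_∈?_ to _∈ℤ?_)
open import Data.List.Membership.Propositional using (_∈_; _∉_)
open import Data.List.Membership.Propositional.Properties
open import Data.List.Properties using (length-map; length-++; length-++-sucʳ; map-cong)
open import Data.List.Relation.Binary.Disjoint.Propositional using (Disjoint)
open import Data.List.Relation.Binary.Subset.Propositional using (_⊆_)
open import Data.List.Relation.Unary.All as All using (All; []; _∷_)
open import Data.List.Relation.Unary.AllPairs using ([]; _∷_)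
open import Data.List.Relation.Unary.Any using (here; there)
open import Data.List.Relation.Unary.Unique.DecPropositional.Properties ℤ._≟_ using (deduplicate-!)
open import Data.List.Relation.Unary.Unique.Propositional using (Unique)
open import Data.List.Relation.Unary.Unique.Propositional.Properties using (map⁺; ++⁺; filter⁺; Unique[x∷xs]⇒x∉xs)
open import Data.Nat as ℕ using (ℕ; zero; suc; NonZero; z≤n; s≤s; _+_; _*_; _∸_; _⊔_; _≤_; _≥_; _<_)
open import Data.Nat.ListAction using (sum)
import Data.Nat.Properties as ℕ
open import Algebra.Properties.CommutativeSemigroup ℕ.+-commutativeSemigroup using (interchange)
open import Data.Product using (∃-syntax; _×_; _,_; proj₁; proj₂)
open import Data.Sum using (inj₁; inj₂)
open import Function using (_∘_; id)
open import Relation.Binary.Definitions using () renaming (Decidable to Decidable₂)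
open import Relation.Binary.PropositionalEquality
open import Relation.Nullary using (¬_; yes; no; ¬?; contradiction)
open import Relation.Unary using (Decidable)
open import Defs

import Algebra.Properties.AbelianGroup ℤ.+-0-abelianGroup as ℤ+
import Data.List.Membership.DecPropositional ℕ._≟_ as ℕList

-- Counting in lists

-- Deleting one occurrence of the head from `ys` still leaves room for the tail, which avoids the
-- head because `xs` is `Unique`.
length-mono-⊆ : ∀ {X : Set} {xs ys : List X} → Unique xs → xs ⊆ ys → length xs ≤ length ys
length-mono-⊆ {xs = []}     _          _     = z≤n
length-mono-⊆ {xs = x ∷ xs} x∷xs!@(_ ∷ xs!) xs⊆ys
  with us , vs , refl ← ∈-∃++ (xs⊆ys (here refl)) =
  ℕ.≤-trans (s≤s (length-mono-⊆ xs! shrink)) (ℕ.≤-reflexive (sym (length-++-sucʳ us x vs)))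
  where
  shrink : xs ⊆ us ++ vs
  shrink {y} y∈xs with ∈-++⁻ us (xs⊆ys (there y∈xs))
  ... | inj₁ y∈us         = ∈-++⁺ˡ y∈us
  ... | inj₂ (here refl)  = contradiction y∈xs (Unique[x∷xs]⇒x∉xs x∷xs!)
  ... | inj₂ (there y∈vs) = ∈-++⁺ʳ us y∈vs

-- Injectivity is asked for on the entries alone, since reduction modulo `d` is injective on a short
-- window but not on all integers.
map⁺-injectiveOn : ∀ {X Y : Set} (f : X → Y) {xs} →
  (∀ {x y} → x ∈ xs → y ∈ xs → f x ≡ f y → x ≡ y) → Unique xs → Unique (map f xs)
map⁺-injectiveOn f {[]}     inj []           = []
map⁺-injectiveOn f {x ∷ xs} inj (x≢ ∷ xs!) =
  All.tabulate fresh ∷ map⁺-injectiveOn f (λ p q → inj (there p) (there q)) xs!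
  where
  fresh : ∀ {y} → y ∈ map f xs → f x ≢ y
  fresh y∈ fx≡y with z , z∈xs , refl ← ∈-map⁻ f y∈ =
    All.lookup x≢ z∈xs (inj (here refl) (there z∈xs) fx≡y)

length-filter-¬ : ∀ {X : Set} {P : X → Set} (P? : Decidable P) xs →
  length (filter P? xs) + length (filter (¬? ∘ P?) xs) ≡ length xs
length-filter-¬ P? []       = refl
length-filter-¬ P? (x ∷ xs) with P? x
... | yes _ = cong suc (length-filter-¬ P? xs)
... | no  _ = trans (ℕ.+-suc _ _) (cong suc (length-filter-¬ P? xs))

sum-map-+ : ∀ {X : Set} (f g : X → ℕ) xs →
  sum (map (λ x → f x + g x) xs) ≡ sum (map f xs) + sum (map g xs)
sum-map-+ f g []       = refl
sum-map-+ f g (x ∷ xs) =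
  trans (cong (_+_ (f x + g x)) (sum-map-+ f g xs)) (interchange (f x) (g x) _ _)

length*≤sum : ∀ {X : Set} (g : X → ℕ) k {xs} → All (λ x → k ≤ g x) xs →
  length xs * k ≤ sum (map g xs)
length*≤sum g k []         = z≤n
length*≤sum g k (k≤ ∷ k≤s) = ℕ.+-mono-≤ k≤ (length*≤sum g k k≤s)

-- If the head falls short of `k`, cancelling one `k` leaves the same hypothesis for the tail. The
-- product form avoids division.
∃≥average : ∀ {X : Set} (g : X → ℕ) k x xs → length (x ∷ xs) * k ≤ sum (map g (x ∷ xs)) →
  ∃[ y ] (y ∈ x ∷ xs × k ≤ g y)
∃≥average g k x []       k≤ = x , here refl , subst₂ _≤_ (ℕ.+-identityʳ k) (ℕ.+-identityʳ (g x)) k≤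
∃≥average g k x (y ∷ xs) k≤ with k ℕ.≤? g x
... | yes k≤gx = x , here refl , k≤gx
... | no  k≰gx
  with z , z∈ , k≤gz ← ∃≥average g k y xs
         (ℕ.+-cancelˡ-≤ k _ _ (ℕ.≤-trans k≤ (ℕ.+-monoˡ-≤ _ (ℕ.≰⇒≥ k≰gx))))
  = z , there z∈ , k≤gz

-- Double counting of the related pairs, by rows and by columns. The induction peels off one row:
-- `single` spreads it over the columns and `cons` merges it with the rest.
sum-filter-swap : ∀ {X Y : Set} {R : X → Y → Set} (R? : Decidable₂ R) xs ys →
  sum (map (λ x → length (filter (R? x) ys)) xs) ≡
  sum (map (λ y → length (filter (λ x → R? x y) xs)) ys)
sum-filter-swap R? []       []       = refl
sum-filter-swap R? []       (y ∷ ys) = sum-filter-swap R? [] ys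
sum-filter-swap R? (x ∷ xs) ys = begin
  length (filter (R? x) ys) + sum (map (λ z → length (filter (R? z) ys)) xs)
    ≡⟨ cong₂ _+_ (single ys) (sum-filter-swap R? xs ys) ⟩
  sum (map (column (x ∷ [])) ys) + sum (map (column xs) ys)
    ≡⟨ sum-map-+ (column (x ∷ [])) (column xs) ys ⟨
  sum (map (λ y → column (x ∷ []) y + column xs y) ys)
    ≡⟨ cong sum (map-cong cons ys) ⟩
  sum (map (column (x ∷ xs)) ys) ∎
  where
  open ≡-Reasoning
  column : List _ → _ → ℕ
  column zs y = length (filter (λ z → R? z y) zs)
  single : ∀ vs → length (filter (R? x) vs) ≡ sum (map (column (x ∷ [])) vs)
  single []       = refl
  single (v ∷ vs) with R? x v
  ... | yes _ = cong suc (single vs)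
  ... | no  _ = single vs
  cons : ∀ y → column (x ∷ []) y + column xs y ≡ column (x ∷ xs) y
  cons y with R? x y
  ... | yes _ = refl
  ... | no  _ = refl

-- Residues of integers

-- The distance between `i` and `j` is at most their maximum, hence below `d`, while it equals the
-- absolute value of `q` times `d`. This forces `q` to be zero.
residue-unique : ∀ {i j d} q → i < d → j < d → + i ℤ.- + j ≡ q ℤ.* + d → i ≡ j
residue-unique {i} {j} {d} q i<d j<d eq with ∣ q ∣ᶻ in ∣q∣≡ | ∣q∣*d<d
  where
  open ℕ.≤-Reasoning
  ∣q∣*d<d : ∣ q ∣ᶻ * d < d
  ∣q∣*d<d = begin-strict
    ∣ q ∣ᶻ * d       ≡⟨ ℤ.abs-* q (+ d) ⟨
    ∣ q ℤ.* + d ∣ᶻ   ≡⟨ cong ∣_∣ᶻ eq ⟨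
    ∣ + i ℤ.- + j ∣ᶻ ≡⟨ cong ∣_∣ᶻ (ℤ.m-n≡m⊖n i j) ⟩
    ∣ i ℤ.⊖ j ∣ᶻ     ≤⟨ ℤ.∣m⊝n∣≤m⊔n i j ⟩
    i ⊔ j            <⟨ ℕ.⊔-lub i<d j<d ⟩
    d                ∎
... | zero  | _ = ℤ.+-injective (ℤ.i-j≡0⇒i≡j (+ i) (+ j)
                    (trans eq (cong (ℤ._* + d) (ℤ.∣i∣≡0⇒i≡0 {q} ∣q∣≡))))
... | suc k | p = contradiction p (ℕ.≤⇒≯ (ℕ.m≤m+n d (k * d)))

[i+d]%d≡i%d : ∀ i d .{{_ : NonZero d}} → (i ℤ.+ + d) %ℕ d ≡ i %ℕ d
[i+d]%d≡i%d i d = residue-unique (ℤ.1ℤ ℤ.+ q ℤ.- q′) (n%ℕd<d j d) (n%ℕd<d i d) (begin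
  r′ ℤ.- r
    ≡⟨ regroup r′ r q′ q (+ d) ⟩
  ((r′ ℤ.+ q′ ℤ.* + d) ℤ.- (r ℤ.+ q ℤ.* + d)) ℤ.+ (q ℤ.- q′) ℤ.* + d
    ≡⟨ cong₂ (λ u v → (u ℤ.- v) ℤ.+ (q ℤ.- q′) ℤ.* + d) (a≡a%ℕn+[a/ℕn]*n j d) (a≡a%ℕn+[a/ℕn]*n i d) ⟨
  (j ℤ.- i) ℤ.+ (q ℤ.- q′) ℤ.* + d
    ≡⟨ collect i (+ d) q q′ ⟩
  (ℤ.1ℤ ℤ.+ q ℤ.- q′) ℤ.* + d ∎)
  where
  open ≡-Reasoning
  j = i ℤ.+ + d
  r = + (i %ℕ d)
  r′ = + (j %ℕ d)
  q = i /ℕ d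
  q′ = j /ℕ d
  regroup : ∀ r′ r q′ q d → r′ ℤ.- r ≡
    ((r′ ℤ.+ q′ ℤ.* d) ℤ.- (r ℤ.+ q ℤ.* d)) ℤ.+ (q ℤ.- q′) ℤ.* d
  regroup = solve-∀
  collect : ∀ i d q q′ → (i ℤ.+ d ℤ.- i) ℤ.+ (q ℤ.- q′) ℤ.* d ≡ (ℤ.1ℤ ℤ.+ q ℤ.- q′) ℤ.* d
  collect = solve-∀

i+∣j-i∣≡j : ∀ {i j} → i ℤ.≤ j → i ℤ.+ + ∣ j ℤ.- i ∣ᶻ ≡ j
i+∣j-i∣≡j {i} {j} i≤j = trans (cong (ℤ._+_ i) (ℤ.0≤i⇒+∣i∣≡i (ℤ.i≤j⇒0≤j-i i≤j))) (add-sub i j)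
  where
  add-sub : ∀ i j → i ℤ.+ (j ℤ.- i) ≡ j
  add-sub = solve-∀

-- The offsets of `i` and `j` from `c` are naturals below `d`, and equal remainders make their
-- difference a multiple of `d`; so `residue-unique` applies to the offsets.
%-injective-window : ∀ {c i j} d .{{_ : NonZero d}} →
  c ℤ.≤ i → i ℤ.< c ℤ.+ + d → c ℤ.≤ j → j ℤ.< c ℤ.+ + d → i %ℕ d ≡ j %ℕ d → i ≡ j
%-injective-window {c} {i} {j} d c≤i i<c+d c≤j j<c+d r≡ = begin
  i                      ≡⟨ i+∣j-i∣≡j c≤i ⟨
  c ℤ.+ + ∣ i ℤ.- c ∣ᶻ  ≡⟨ cong (λ k → c ℤ.+ + k) k≡l ⟩
  c ℤ.+ + ∣ j ℤ.- c ∣ᶻ  ≡⟨ i+∣j-i∣≡j c≤j ⟩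
  j                      ∎
  where
  open ≡-Reasoning
  i/ = i /ℕ d
  j/ = j /ℕ d
  sub-sub : ∀ c x y → (x ℤ.- c) ℤ.- (y ℤ.- c) ≡ x ℤ.- y
  sub-sub = solve-∀
  cancel : ∀ r p q d → (r ℤ.+ p ℤ.* d) ℤ.- (r ℤ.+ q ℤ.* d) ≡ (p ℤ.- q) ℤ.* d
  cancel = solve-∀
  abs : ∀ {x} → c ℤ.≤ x → + ∣ x ℤ.- c ∣ᶻ ≡ x ℤ.- c
  abs c≤x = ℤ.0≤i⇒+∣i∣≡i (ℤ.i≤j⇒0≤j-i c≤x)
  small : ∀ {x} → c ℤ.≤ x → x ℤ.< c ℤ.+ + d → ∣ x ℤ.- c ∣ᶻ < d
  small c≤x x<c+d = ℕ.≰⇒> λ d≤x-c →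
    ℤ.<⇒≱ x<c+d (subst (c ℤ.+ + d ℤ.≤_) (i+∣j-i∣≡j c≤x) (ℤ.+-monoʳ-≤ c (ℤ.+≤+ d≤x-c)))
  k≡l : ∣ i ℤ.- c ∣ᶻ ≡ ∣ j ℤ.- c ∣ᶻ
  k≡l = residue-unique (i/ ℤ.- j/) (small c≤i i<c+d) (small c≤j j<c+d) (begin
    + ∣ i ℤ.- c ∣ᶻ ℤ.- + ∣ j ℤ.- c ∣ᶻ
      ≡⟨ cong₂ ℤ._-_ (abs c≤i) (abs c≤j) ⟩
    (i ℤ.- c) ℤ.- (j ℤ.- c)
      ≡⟨ sub-sub c i j ⟩
    i ℤ.- j
      ≡⟨ cong₂ ℤ._-_ (a≡a%ℕn+[a/ℕn]*n i d) (a≡a%ℕn+[a/ℕn]*n j d) ⟩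
    (+ (i %ℕ d) ℤ.+ i/ ℤ.* + d) ℤ.- (+ (j %ℕ d) ℤ.+ j/ ℤ.* + d)
      ≡⟨ cong (λ r → (+ r ℤ.+ i/ ℤ.* + d) ℤ.- (+ (j %ℕ d) ℤ.+ j/ ℤ.* + d)) r≡ ⟩
    (+ (j %ℕ d) ℤ.+ i/ ℤ.* + d) ℤ.- (+ (j %ℕ d) ℤ.+ j/ ℤ.* + d)
      ≡⟨ cancel (+ (j %ℕ d)) i/ j/ (+ d) ⟩
    (i/ ℤ.- j/) ℤ.* + d ∎)

-- Sumsets

∣∣-lower : ∀ {X Y} → Unique Y → Y ⊆ X → length Y ≤ ∣ X ∣
∣∣-lower Y! Y⊆X = length-mono-⊆ Y! (∈-deduplicate⁺ ℤ._≟_ ∘ Y⊆X)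

translate-⊆ : ∀ {X A C c} → X ⊆ A → c ∈ C → map (ℤ._+ c) X ⊆ A ⊕ C
translate-⊆ {c = c} X⊆A c∈C y∈ with x , x∈X , refl ← ∈-map⁻ (ℤ._+ c) y∈ =
  ∈-cartesianProductWith⁺ ℤ._+_ (X⊆A x∈X) c∈C

translate-! : ∀ {X} c → Unique X → Unique (map (ℤ._+ c) X)
translate-! c = map⁺ (ℤ+.∙-cancelʳ c _ _)

-- The translates `A + b₀`, `U + b₁` and `N + b` are pairwise disjoint: `U-new` separates the first
-- two, and `Old` holds on both of these but fails on the third. `Old` abstracts "in a class met by
-- `A + b₀`". `S` may repeat entries, whereas `A` is a list that can be counted.
∣⊕∣-lower : ∀ {S A U N b₀ b₁ b} (Old : ℤ → Set) → A ⊆ S →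
  Unique A → Unique U → Unique N → U ⊆ A → N ⊆ A →
  (∀ {a} → a ∈ A → Old (a ℤ.+ b₀)) →
  (∀ a → Old (a ℤ.+ b₀) → Old (a ℤ.+ b₁)) →
  (∀ {u} → u ∈ U → u ℤ.+ b₁ ∉ map (ℤ._+ b₀) A) →
  (∀ {a} → a ∈ N → ¬ Old (a ℤ.+ b)) →
  length A + (length U + length N) ≤ ∣ S ⊕ (b₀ ∷ b₁ ∷ b ∷ []) ∣
∣⊕∣-lower {S} {A} {U} {N} {b₀} {b₁} {b} Old A⊆S A! U! N! U⊆A N⊆A old₀ old₁ U-new N-new = begin
  length A + (length U + length N)     ≡⟨ cong₂ _+_ (length-map _ A) (cong₂ _+_ (length-map _ U) (length-map _ N)) ⟨
  length W₀ + (length W₁ + length W₂)  ≡⟨ cong (_+_ (length W₀)) (length-++ W₁) ⟨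
  length W₀ + length (W₁ ++ W₂)        ≡⟨ length-++ W₀ ⟨
  length (W₀ ++ W₁ ++ W₂)              ≤⟨ ∣∣-lower W! W⊆S⊕T ⟩
  ∣ S ⊕ T ∣                            ∎
  where
  open ℕ.≤-Reasoning
  T = b₀ ∷ b₁ ∷ b ∷ []
  W₀ = map (ℤ._+ b₀) A
  W₁ = map (ℤ._+ b₁) U
  W₂ = map (ℤ._+ b) N

  old-W₁ : ∀ {y} → y ∈ W₁ → Old y
  old-W₁ y∈ with u , u∈U , refl ← ∈-map⁻ (ℤ._+ b₁) y∈ = old₁ u (old₀ (U⊆A u∈U))

  old-W₀ : ∀ {y} → y ∈ W₀ → Old y
  old-W₀ y∈ with a , a∈A , refl ← ∈-map⁻ (ℤ._+ b₀) y∈ = old₀ a∈A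

  new-W₂ : ∀ {y} → y ∈ W₂ → ¬ Old y
  new-W₂ y∈ with a , a∈N , refl ← ∈-map⁻ (ℤ._+ b) y∈ = N-new a∈N

  W₀#W₁₂ : Disjoint W₀ (W₁ ++ W₂)
  W₀#W₁₂ (y∈₀ , y∈₁₂) with ∈-++⁻ W₁ y∈₁₂
  ... | inj₁ y∈₁ with u , u∈U , refl ← ∈-map⁻ (ℤ._+ b₁) y∈₁ = U-new u∈U y∈₀
  ... | inj₂ y∈₂ = new-W₂ y∈₂ (old-W₀ y∈₀)

  W! : Unique (W₀ ++ W₁ ++ W₂)
  W! = ++⁺ (translate-! b₀ A!)
         (++⁺ (translate-! b₁ U!) (translate-! b N!) λ (y∈₁ , y∈₂) → new-W₂ y∈₂ (old-W₁ y∈₁))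
         W₀#W₁₂

  W⊆S⊕T : W₀ ++ W₁ ++ W₂ ⊆ S ⊕ T
  W⊆S⊕T y∈ with ∈-++⁻ W₀ y∈
  ... | inj₁ y∈₀ = translate-⊆ {C = T} A⊆S (here refl) y∈₀
  ... | inj₂ y∈₁₂ with ∈-++⁻ W₁ y∈₁₂
  ...   | inj₁ y∈₁ = translate-⊆ {C = T} (A⊆S ∘ U⊆A) (there (here refl)) y∈₁
  ...   | inj₂ y∈₂ = translate-⊆ {C = T} (A⊆S ∘ N⊆A) (there (there (here refl))) y∈₂

-- Largest elements of residue classes

max-∈ : ∀ x xs → max x xs ∈ x ∷ xs
max-∈ x xs = argmax-all id {P = _∈ x ∷ xs} (here refl) (All.tabulate there)

min-∈ : ∀ x xs → min x xs ∈ x ∷ xs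
min-∈ x xs = argmin-all id {P = _∈ x ∷ xs} (here refl) (All.tabulate there)

isTop? : ∀ b₀ b₁ A → Decidable (λ a → a ℤ.+ b₁ ∉ map (ℤ._+ b₀) A)
isTop? b₀ b₁ A a = ¬? (a ℤ.+ b₁ ∈ℤ? map (ℤ._+ b₀) A)

-- For `b₀ < b₁` these are the upper ends of the maximal runs in `A` with step `b₁ - b₀`; one class
-- may contain several.
tops : ℤ → ℤ → List ℤ → List ℤ
tops b₀ b₁ A = filter (isTop? b₀ b₁ A) A

-- Let `u` be the largest element of `A` in the class of `a`. If `u + b₁ = w + b₀` with `w ∈ A`,
-- then `w` is in that class too, so `w ≤ u`, which contradicts `b₀ < b₁`. Hence `A + b₀` meets at
-- most as many classes as there are tops.
class-of-top : ∀ (f : ℤ → ℕ) {b₀ b₁ A} → b₀ ℤ.< b₁ → (∀ a → f (a ℤ.+ b₁) ≡ f (a ℤ.+ b₀)) →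
  ∀ {a} → a ∈ A → f (a ℤ.+ b₀) ∈ map (λ u → f (u ℤ.+ b₀)) (tops b₀ b₁ A)
class-of-top f {b₀} {b₁} {A} b₀<b₁ periodic {a} a∈A =
  subst (_∈ map f₀ (tops b₀ b₁ A)) u~a (∈-map⁺ f₀ (∈-filter⁺ (isTop? b₀ b₁ A) u∈A u-top))
  where
  f₀ : ℤ → ℕ
  f₀ x = f (x ℤ.+ b₀)
  sameClass? : Decidable (λ x → f₀ x ≡ f₀ a)
  sameClass? x = f₀ x ℕ.≟ f₀ a
  C = filter sameClass? A
  -- The default value `a` is itself an element of `A` in the right class, so the maximum is one as
  -- well.
  u = max a C
  u∈A×u~a : u ∈ A × f₀ u ≡ f₀ a
  u∈A×u~a = argmax-all id {P = λ x → x ∈ A × f₀ x ≡ f₀ a} (a∈A , refl) (All.tabulate (∈-filter⁻ sameClass?))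
  u∈A = proj₁ u∈A×u~a
  u~a = proj₂ u∈A×u~a
  above : ∀ {w} → w ∈ A → u ℤ.+ b₁ ≢ w ℤ.+ b₀
  above {w} w∈A eq = ℤ.<-irrefl (sym eq) (ℤ.+-mono-≤-< (All.lookup (xs≤max a C) w∈C) b₀<b₁)
    where
    w∈C : w ∈ C
    w∈C = ∈-filter⁺ sameClass? w∈A (trans (cong f (sym eq)) (trans (periodic u) u~a))
  u-top : u ℤ.+ b₁ ∉ map (ℤ._+ b₀) A
  u-top u+b₁∈ = let w , w∈A , eq = ∈-map⁻ (ℤ._+ b₀) u+b₁∈ in above w∈A eq

-- Averaging over the third translate

-- f stands for reduction modulo b₁ - b₀.
three-translates : ∀ {S A} (f : ℤ → ℕ) b₀ b₁ x xs → let B = x ∷ xs in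
  A ⊆ S → Unique A → Unique B → b₀ ℤ.< b₁ → (∀ a → f (a ℤ.+ b₁) ≡ f (a ℤ.+ b₀)) →
  (∀ a {b c} → b ∈ B → c ∈ B → f (a ℤ.+ b) ≡ f (a ℤ.+ c) → b ≡ c) → length B ≤ length A →
  ∃[ b ] (b ∈ B × length A + length B ≤ ∣ S ⊕ (b₀ ∷ b₁ ∷ b ∷ []) ∣)
three-translates {S} {A} f b₀ b₁ x xs A⊆S A! B! b₀<b₁ periodic injective ∣B∣≤∣A∣ =
  -- Pairs `(a , b)` with `a + b` in a new class are counted: each `a` gives at least `n ∸ length U`
  -- of them, and there are at least `n` choices of `a`, so some `b` among the `n` gets at least the
  -- same number.
  finish (∃≥average (length ∘ N) (n ∸ length U) x xs (begin
    n * (n ∸ length U)                              ≤⟨ ℕ.*-monoˡ-≤ (n ∸ length U) ∣B∣≤∣A∣ ⟩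
    length A * (n ∸ length U)                       ≤⟨ length*≤sum _ _ (All.tabulate {xs = A} λ {a} _ → many-new a) ⟩
    sum (map (λ a → length (filter (new? a) B)) A)  ≡⟨ sum-filter-swap new? A B ⟩
    sum (map (length ∘ N) B)                        ∎))
  where
  open ℕ.≤-Reasoning
  B = x ∷ xs
  n = length B
  U = tops b₀ b₁ A
  top? = isTop? b₀ b₁ A
  -- By `class-of-top` this lists every class met by `A + b₀`, possibly with repetitions; its length
  -- is exactly that of `U`.
  R = map (λ u → f (u ℤ.+ b₀)) U

  old? : ∀ a → Decidable (λ b → f (a ℤ.+ b) ∈ R)
  old? a b = f (a ℤ.+ b) ℕList.∈? R
  new? : Decidable₂ (λ a b → f (a ℤ.+ b) ∉ R)
  new? a b = ¬? (old? a b)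
  isNew? : ∀ b → Decidable (λ a → f (a ℤ.+ b) ∉ R)
  isNew? b a = new? a b

  N : ℤ → List ℤ
  N b = filter (isNew? b) A

  -- For fixed `a`, the `b` with `a + b` in an old class have distinct classes, all listed in `R`;
  -- so there are at most `length U` of them.
  many-new : ∀ a → n ∸ length U ≤ length (filter (new? a) B)
  many-new a = ℕ.m≤n+o⇒m∸n≤o n (length U) (begin
    n                                        ≡⟨ length-filter-¬ (old? a) B ⟨
    length old + length (filter (new? a) B)  ≤⟨ ℕ.+-monoˡ-≤ _ ∣old∣≤∣U∣ ⟩
    length U + length (filter (new? a) B)    ∎)
    where
    old = filter (old? a) B
    old⊆B : old ⊆ B
    old⊆B = proj₁ ∘ ∈-filter⁻ (old? a)
    classes = map (λ b → f (a ℤ.+ b)) old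
    classes⊆R : classes ⊆ R
    classes⊆R r∈ with b , b∈ , refl ← ∈-map⁻ (λ b → f (a ℤ.+ b)) r∈ =
      proj₂ (∈-filter⁻ (old? a) {xs = B} b∈)
    ∣old∣≤∣U∣ : length old ≤ length U
    ∣old∣≤∣U∣ = begin
      length old      ≡⟨ length-map _ old ⟨
      length classes  ≤⟨ length-mono-⊆ (map⁺-injectiveOn _
                           (λ p q → injective a (old⊆B p) (old⊆B q)) (filter⁺ (old? a) B!)) classes⊆R ⟩
      length R        ≡⟨ length-map _ U ⟩
      length U        ∎

  finish : ∃[ b ] (b ∈ B × n ∸ length U ≤ length (N b)) →
    ∃[ b ] (b ∈ B × length A + n ≤ ∣ S ⊕ (b₀ ∷ b₁ ∷ b ∷ []) ∣)
  finish (b , b∈B , ∣N∣≥) = b , b∈B , (begin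
    -- With truncated subtraction this also covers `length U > n`, where the third translate has
    -- nothing to add.
    length A + n                            ≤⟨ ℕ.+-monoʳ-≤ (length A) (ℕ.m≤n+m∸n n (length U)) ⟩
    length A + (length U + (n ∸ length U))  ≤⟨ ℕ.+-monoʳ-≤ (length A) (ℕ.+-monoʳ-≤ (length U) ∣N∣≥) ⟩
    length A + (length U + length (N b))    ≤⟨ ∣⊕∣-lower (λ y → f y ∈ R) A⊆S A! (filter⁺ top? A!) (filter⁺ (isNew? b) A!)
                                                 (proj₁ ∘ ∈-filter⁻ top?) (proj₁ ∘ ∈-filter⁻ (isNew? b))
                                                 (class-of-top f b₀<b₁ periodic)
                                                 (λ a → subst (_∈ R) (sym (periodic a)))
                                                 (proj₂ ∘ ∈-filter⁻ top? {xs = A})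
                                                 (proj₂ ∘ ∈-filter⁻ (isNew? b) {xs = A}) ⟩
    ∣ S ⊕ (b₀ ∷ b₁ ∷ b ∷ []) ∣              ∎)

-- With `d = b₁ - b₀`, adding `b₁` or `b₀` gives the same residue, and the elements `a + b` lie in
-- the half-open window of length `d` from `a + b₀`, on which residues are distinct.
window-translates : ∀ {S A} b₀ b₁ x xs → let B = x ∷ xs in
  A ⊆ S → Unique A → Unique B → b₀ ℤ.< b₁ → (∀ {b} → b ∈ B → b₀ ℤ.≤ b × b ℤ.< b₁) → length B ≤ length A →
  ∃[ b ] (b ∈ B × length A + length B ≤ ∣ S ⊕ (b₀ ∷ b₁ ∷ b ∷ []) ∣)
window-translates b₀ b₁ x xs A⊆S A! B! b₀<b₁ window =
  three-translates (_%ℕ d) b₀ b₁ x xs A⊆S A! B! b₀<b₁ periodic injective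
  where
  d = ∣ b₁ ℤ.- b₀ ∣ᶻ

  b₀+d≡b₁ : b₀ ℤ.+ + d ≡ b₁
  b₀+d≡b₁ = i+∣j-i∣≡j (ℤ.<⇒≤ b₀<b₁)

  a+b₀+d≡a+b₁ : ∀ a → a ℤ.+ b₀ ℤ.+ + d ≡ a ℤ.+ b₁
  a+b₀+d≡a+b₁ a = trans (ℤ.+-assoc a b₀ (+ d)) (cong (ℤ._+_ a) b₀+d≡b₁)

  instance
    d≢0 : NonZero d
    d≢0 = ℕ.≢-nonZero λ d≡0 → ℤ.<-irrefl
      (trans (sym (ℤ.+-identityʳ b₀)) (trans (cong (λ k → b₀ ℤ.+ + k) (sym d≡0)) b₀+d≡b₁)) b₀<b₁

  periodic : ∀ a → (a ℤ.+ b₁) %ℕ d ≡ (a ℤ.+ b₀) %ℕ d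
  periodic a = trans (cong (_%ℕ d) (sym (a+b₀+d≡a+b₁ a))) ([i+d]%d≡i%d (a ℤ.+ b₀) d)

  injective : ∀ a {b c} → b ∈ x ∷ xs → c ∈ x ∷ xs → (a ℤ.+ b) %ℕ d ≡ (a ℤ.+ c) %ℕ d → b ≡ c
  injective a {b} {c} b∈ c∈ eq =
    ℤ+.∙-cancelˡ a b c (%-injective-window d (lower b∈) (upper b∈) (lower c∈) (upper c∈) eq)
    where
    lower : ∀ {b} → b ∈ x ∷ xs → a ℤ.+ b₀ ℤ.≤ a ℤ.+ b
    lower b∈ = ℤ.+-monoʳ-≤ a (proj₁ (window b∈))
    upper : ∀ {b} → b ∈ x ∷ xs → a ℤ.+ b ℤ.< a ℤ.+ b₀ ℤ.+ + d
    upper {b} b∈ = subst (a ℤ.+ b ℤ.<_) (sym (a+b₀+d≡a+b₁ a)) (ℤ.+-monoʳ-< a (proj₂ (window b∈)))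

-- Deduplication and the choice of the three elements

theorem1 : (A B : FinSubset) → A ≢ [] → B ≢ [] → ∣ A ∣ ≥ ∣ B ∣ →
    ∃[ b₁ ] ∃[ b₂ ] ∃[ b₃ ] (b₁ ∈ B × b₂ ∈ B × b₃ ∈ B ×
    ∣ A ⊕ (b₁ ∷ b₂ ∷ b₃ ∷ []) ∣ ≥ ∣ A ∣ + ∣ B ∣ ∸ 1)
theorem1 A []         _ B≢[] _   = contradiction refl B≢[]
-- Passing the list with an equation lets the case split name its head, needed for the minimum,
-- while facts about `B⁻` stay available by substitution.
theorem1 A B@(y ∷ ys) _ _    A≥B = choose B⁻ refl
  where
  open ℕ.≤-Reasoning
  A′ = deduplicate ℤ._≟_ A
  A′⊆A : A′ ⊆ A
  A′⊆A = ∈-deduplicate⁻ ℤ._≟_ A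

  b₁ = max y ys
  b₁∈B = max-∈ y ys
  ≢b₁? : Decidable (_≢ b₁)
  ≢b₁? b = ¬? (b ℤ.≟ b₁)
  -- The maximum must go: it is congruent to the minimum modulo their difference and would spoil
  -- distinctness of residues.
  B⁻ = filter ≢b₁? (deduplicate ℤ._≟_ B)

  B⁻! : Unique B⁻
  B⁻! = filter⁺ ≢b₁? (deduplicate-! B)
  B⁻⊆B : B⁻ ⊆ B
  B⁻⊆B = ∈-deduplicate⁻ ℤ._≟_ B ∘ proj₁ ∘ ∈-filter⁻ ≢b₁?

  ≤b₁ : ∀ {b} → b ∈ B → b ℤ.≤ b₁
  ≤b₁ (here refl) = ⊥≤max y ys
  ≤b₁ (there b∈)  = All.lookup (xs≤max y ys) b∈

  <b₁ : ∀ {b} → b ∈ B⁻ → b ℤ.< b₁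
  <b₁ b∈ = ℤ.≤∧≢⇒< (≤b₁ (B⁻⊆B b∈)) (proj₂ (∈-filter⁻ ≢b₁? {xs = deduplicate ℤ._≟_ B} b∈))

  ∣B∣≤1+∣B⁻∣ : ∣ B ∣ ≤ suc (length B⁻)
  ∣B∣≤1+∣B⁻∣ = length-mono-⊆ (deduplicate-! B) split
    where
    split : deduplicate ℤ._≟_ B ⊆ b₁ ∷ B⁻
    split {b} b∈ with b ℤ.≟ b₁
    ... | yes b≡b₁ = here b≡b₁
    ... | no  b≢b₁ = there (∈-filter⁺ ≢b₁? b∈ b≢b₁)

  -- The `1` subtracted in the theorem pays for `b₁`, the one element missing from `B⁻`.
  reduce : ∀ {k} → ∣ A ∣ + length B⁻ ≤ k → ∣ A ∣ + ∣ B ∣ ∸ 1 ≤ k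
  reduce {k} ≤k = ℕ.m≤n+o⇒m∸n≤o (∣ A ∣ + ∣ B ∣) 1 (begin
    ∣ A ∣ + ∣ B ∣            ≤⟨ ℕ.+-monoʳ-≤ ∣ A ∣ ∣B∣≤1+∣B⁻∣ ⟩
    ∣ A ∣ + suc (length B⁻)  ≡⟨ ℕ.+-suc ∣ A ∣ (length B⁻) ⟩
    suc (∣ A ∣ + length B⁻)  ≤⟨ s≤s ≤k ⟩
    suc k                    ∎)

  choose : ∀ zs → B⁻ ≡ zs → ∃[ b₁ ] ∃[ b₂ ] ∃[ b₃ ] (b₁ ∈ B × b₂ ∈ B × b₃ ∈ B ×
    ∣ A ⊕ (b₁ ∷ b₂ ∷ b₃ ∷ []) ∣ ≥ ∣ A ∣ + ∣ B ∣ ∸ 1)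
  -- Here `b₁` is the only element of `B`, and the single translate `A + b₁` already reaches the
  -- bound.
  choose [] B⁻≡[] = b₁ , b₁ , b₁ , b₁∈B , b₁∈B , b₁∈B , reduce (begin
    ∣ A ∣ + length B⁻              ≡⟨ cong (λ zs → ∣ A ∣ + length zs) B⁻≡[] ⟩
    ∣ A ∣ + 0                      ≡⟨ ℕ.+-identityʳ ∣ A ∣ ⟩
    ∣ A ∣                          ≡⟨ length-map (ℤ._+ b₁) A′ ⟨
    length (map (ℤ._+ b₁) A′)      ≤⟨ ∣∣-lower (translate-! b₁ (deduplicate-! A))
                                        (translate-⊆ {C = T} A′⊆A (here refl)) ⟩
    ∣ A ⊕ T ∣                      ∎)
    where T = b₁ ∷ b₁ ∷ b₁ ∷ []
  -- As every element of `B⁻` lies below `b₁`, its minimum `b₀` is the minimum of `B` and differs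
  -- from `b₁`. The element `b` comes from the averaging.
  choose (x ∷ xs) B⁻≡ = b₀ , b₁ , b , zs⊆B b₀∈ , b₁∈B , zs⊆B b∈ , reduce
    (subst (λ zs → ∣ A ∣ + length zs ≤ ∣ A ⊕ (b₀ ∷ b₁ ∷ b ∷ []) ∣) (sym B⁻≡) bound)
    where
    b₀ = min x xs
    b₀∈ = min-∈ x xs
    zs⊆B⁻ : x ∷ xs ⊆ B⁻
    zs⊆B⁻ = subst (_ ∈_) (sym B⁻≡)
    zs⊆B : x ∷ xs ⊆ B
    zs⊆B = B⁻⊆B ∘ zs⊆B⁻
    found = window-translates b₀ b₁ x xs A′⊆A (deduplicate-! A) (subst Unique B⁻≡ B⁻!) (<b₁ (zs⊆B⁻ b₀∈))
      (λ b∈ → All.lookup (min≤⊤ x xs ∷ min≤xs x xs) b∈ , <b₁ (zs⊆B⁻ b∈))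
      (ℕ.≤-trans (length-mono-⊆ (subst Unique B⁻≡ B⁻!) (∈-deduplicate⁺ ℤ._≟_ ∘ zs⊆B)) A≥B)
    b = proj₁ found
    b∈ = proj₁ (proj₂ found)
    bound = proj₂ (proj₂ found)
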